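{- Let $m$ and $n$ be positive integers. Then $$\binom{m+n-2}{m-1}\binom{n}{m}\binom{2n}{n}\equiv 0\pmod{m+n}.$$
   Context: Binomial coefficients $\binom{a}{b}$ are zero when $b<0$ or $b>a$ (for nonnegative integer $a$). -}

module Defs where

{-# OPTIONS --safe #-}
-- Put N = m + n, A = C(N-2, m-1) and B = C(N, m).  Trinomial revision gives
-- C(n, m) C(2n, n) = B C(2n, N), so it is enough that N divides A B.
-- Absorption gives m C(N-1, m) = (N-1) A, that is A = N A - m C(N-1, m), and
-- m B = N C(N-1, m-1); hence N divides A B = N A B - (m B) C(N-1, m).
module Submission where

open import Defs
open import Data.Nat using (ℕ; NonZero; _+_; _*_; _∸_)
open import Data.Nat.Combinatorics using (_C_)
open import Data.Nat.Divisibility using (_∣_)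

open import Data.Nat using (suc; _!; _≤_; s≤s)
open import Data.Nat.Combinatorics using (nCk≡n!/k![n-k]!; k![n∸k]!∣n!; k>n⇒nCk≡0)
open import Data.Nat.Divisibility
  using (∣m+n∣m⇒∣n; m∣m*n; ∣m⇒∣m*n; _∣0)
open import Data.Nat.DivMod using (m/n*n≡m)
open import Data.Nat.Properties
open import Data.Nat.Tactic.RingSolver using (solve-∀)
open import Relation.Binary.PropositionalEquality
open import Relation.Nullary using (yes; no)

open ≡-Reasoning

-- The factorial formula without division, so that the binomial identities below reduce to
-- cancelling nonzero factorials.
nCk*k![n∸k]!≡n! : ∀ {n k} → k ≤ n → (n C k) * (k ! * (n ∸ k) !) ≡ n !
nCk*k![n∸k]!≡n! {n} {k} k≤n =
  trans (cong (_* (k ! * (n ∸ k) !)) (nCk≡n!/k![n-k]! k≤n))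
        (m/n*n≡m (k![n∸k]!∣n! k≤n))
  where instance _ = k !* (n ∸ k) !≢0

-- Multiplied by `k ! * (n ∸ k) !`, both sides become `suc n !`, since `suc n ∸ suc k` reduces to
-- `n ∸ k`.
absorption : ∀ {n k} → k ≤ n → suc k * (suc n C suc k) ≡ suc n * (n C k)
absorption {n} {k} k≤n = *-cancelʳ-≡ _ _ (k ! * (n ∸ k) !) (begin
  suc k * (suc n C suc k) * (k ! * (n ∸ k) !)
    ≡⟨ rearrange (suc k) (suc n C suc k) (k !) ((n ∸ k) !) ⟩
  (suc n C suc k) * (suc k ! * (n ∸ k) !)
    ≡⟨ nCk*k![n∸k]!≡n! (s≤s k≤n) ⟩
  suc n * n !
    ≡⟨ cong (suc n *_) (nCk*k![n∸k]!≡n! k≤n) ⟨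
  suc n * ((n C k) * (k ! * (n ∸ k) !))
    ≡⟨ *-assoc (suc n) (n C k) _ ⟨
  suc n * (n C k) * (k ! * (n ∸ k) !) ∎)
  where
  instance _ = k !* (n ∸ k) !≢0
  rearrange : ∀ s c x y → s * c * (x * y) ≡ c * (s * x * y)
  rearrange = solve-∀

-- Both sides times `m ! * (n ∸ m) ! * l !` equal `(l + n) !`. Taking `l` as the parameter keeps
-- subtraction out of the statement; the theorem uses `l = n`.
trinomial-revision : ∀ l {m n} → m ≤ n →
  (n C m) * ((l + n) C n) ≡ ((l + m) C m) * ((l + n) C (l + m))
trinomial-revision l {m} {n} m≤n = *-cancelʳ-≡ _ _ (m ! * (n ∸ m) ! * l !) (begin
  (n C m) * ((l + n) C n) * (m ! * (n ∸ m) ! * l !)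
    ≡⟨ rearrange₁ (n C m) ((l + n) C n) (m !) ((n ∸ m) !) (l !) ⟩
  ((l + n) C n) * ((n C m) * (m ! * (n ∸ m) !) * l !)
    ≡⟨ cong (λ x → ((l + n) C n) * (x * l !)) (nCk*k![n∸k]!≡n! m≤n) ⟩
  ((l + n) C n) * (n ! * l !)
    ≡⟨ cong (λ x → ((l + n) C n) * (n ! * x !)) (m+n∸n≡m l n) ⟨
  ((l + n) C n) * (n ! * (l + n ∸ n) !)
    ≡⟨ nCk*k![n∸k]!≡n! (m≤n+m n l) ⟩
  (l + n) !
    ≡⟨ nCk*k![n∸k]!≡n! (+-monoʳ-≤ l m≤n) ⟨
  ((l + n) C (l + m)) * ((l + m) ! * (l + n ∸ (l + m)) !)
    ≡⟨ cong (λ x → ((l + n) C (l + m)) * ((l + m) ! * x !)) ([m+n]∸[m+o]≡n∸o l n m) ⟩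
  ((l + n) C (l + m)) * ((l + m) ! * (n ∸ m) !)
    ≡⟨ cong (λ x → ((l + n) C (l + m)) * (x * (n ∸ m) !)) (nCk*k![n∸k]!≡n! (m≤n+m m l)) ⟨
  ((l + n) C (l + m)) * (((l + m) C m) * (m ! * (l + m ∸ m) !) * (n ∸ m) !)
    ≡⟨ cong (λ x → ((l + n) C (l + m)) * (((l + m) C m) * (m ! * x !) * (n ∸ m) !)) (m+n∸n≡m l m) ⟩
  ((l + n) C (l + m)) * (((l + m) C m) * (m ! * l !) * (n ∸ m) !)
    ≡⟨ rearrange₂ ((l + m) C m) ((l + n) C (l + m)) (m !) ((n ∸ m) !) (l !) ⟩
  ((l + m) C m) * ((l + n) C (l + m)) * (m ! * (n ∸ m) ! * l !) ∎)
  where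
  instance
    _ = m !* (n ∸ m) !≢0
    _ = l !≢0
    _ = m*n≢0 (m ! * (n ∸ m) !) (l !)
  rearrange₁ : ∀ a b x y z → a * b * (x * y * z) ≡ b * (a * (x * y) * z)
  rearrange₁ = solve-∀
  rearrange₂ : ∀ a b x y z → b * (a * (x * z) * y) ≡ a * b * (x * y * z)
  rearrange₂ = solve-∀

-- Here `s` is N - 2 and `a` is m - 1. The subtraction in the divisibility argument is replaced by a
-- sum: N divides `N * (A * B)` and its first summand `suc a * B * D`, hence the other one.
2+s∣sCa*[2+s]C[1+a] : ∀ {s a} → a ≤ s →
  suc (suc s) ∣ (s C a) * (suc (suc s) C suc a)
2+s∣sCa*[2+s]C[1+a] {s} {a} a≤s =
  ∣m+n∣m⇒∣n (subst (N ∣_) sum≡ (m∣m*n (A * B))) N∣mBD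
  where
  N = suc (suc s)
  A = s C a
  B = N C suc a
  D = suc s C suc a

  N∣mBD : N ∣ suc a * B * D
  -- Absorption in row N: `suc a * B` is N times `suc s C a`.
  N∣mBD = ∣m⇒∣m*n D (subst (N ∣_) (sym (absorption (m≤n⇒m≤1+n a≤s))) (m∣m*n (suc s C a)))

  expand : ∀ t x y → suc t * (x * y) ≡ (t * x) * y + x * y
  expand = solve-∀

  swap : ∀ m d b → m * d * b ≡ m * b * d
  swap = solve-∀

  sum≡ : N * (A * B) ≡ suc a * B * D + A * B
  sum≡ = begin
    N * (A * B)             ≡⟨ expand (suc s) A B ⟩
    -- Absorption one row lower, in row N - 1, trades `suc s * A` for `suc a * D`.
    suc s * A * B + A * B   ≡⟨ cong (λ x → x * B + A * B) (absorption a≤s) ⟨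
    suc a * D * B + A * B   ≡⟨ cong (_+ A * B) (swap (suc a) D B) ⟩
    suc a * B * D + A * B   ∎

[m+n]∣[m+n∸2]C[m∸1]*[m+n]Cm : ∀ m n → .{{_ : NonZero m}} → .{{_ : NonZero n}} →
  (m + n) ∣ ((m + n ∸ 2) C (m ∸ 1)) * ((m + n) C m)
-- The rewrite exposes both successors of m + n, so `m + n ∸ 2` computes to `a + b`.
[m+n]∣[m+n∸2]C[m∸1]*[m+n]Cm (suc a) (suc b) rewrite +-suc a b =
  2+s∣sCa*[2+s]C[1+a] (m≤m+n a b)

theorem2 : ∀ (m n : ℕ) → .{{_ : NonZero m}} → .{{_ : NonZero n}} →
    (m + n) ∣ (((m + n ∸ 2) C (m ∸ 1)) * (n C m) * ((2 * n) C n))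
theorem2 m n with m ≤? n
-- For m > n the factor `n C m` vanishes; trinomial revision is needed only for m ≤ n.
... | no m≰n = subst (m + n ∣_) (sym product≡0) ((m + n) ∣0)
  where
  A = (m + n ∸ 2) C (m ∸ 1)
  product≡0 : A * (n C m) * ((2 * n) C n) ≡ 0
  product≡0 = cong (_* ((2 * n) C n))
    (trans (cong (A *_) (k>n⇒nCk≡0 (≰⇒> m≰n))) (*-zeroʳ A))
... | yes m≤n = subst (m + n ∣_) (sym product≡)
    (∣m⇒∣m*n ((n + n) C (n + m)) ([m+n]∣[m+n∸2]C[m∸1]*[m+n]Cm m n))
  where
  A = (m + n ∸ 2) C (m ∸ 1)
  product≡ : A * (n C m) * ((2 * n) C n) ≡ A * ((m + n) C m) * ((n + n) C (n + m))
  product≡ = begin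
    A * (n C m) * ((2 * n) C n)
      -- `2 * n` unfolds to `n + (n + 0)`.
      ≡⟨ cong (λ x → A * (n C m) * ((n + x) C n)) (+-identityʳ n) ⟩
    A * (n C m) * ((n + n) C n)
      ≡⟨ *-assoc A (n C m) _ ⟩
    A * ((n C m) * ((n + n) C n))
      ≡⟨ cong (A *_) (trinomial-revision n m≤n) ⟩
    A * (((n + m) C m) * ((n + n) C (n + m)))
      ≡⟨ *-assoc A ((n + m) C m) _ ⟨
    A * ((n + m) C m) * ((n + n) C (n + m))
      ≡⟨ cong (λ x → A * (x C m) * ((n + n) C (n + m))) (+-comm n m) ⟩
    A * ((m + n) C m) * ((n + n) C (n + m)) ∎
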